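{- Let $G$ be a finite, simple, connected $3$-$\gamma_{c}$-critical graph, let $S$ be a minimum vertex cut set of $G$ and $I$ a maximum independent set of $G$. If $\kappa(G) + 1 \leq \alpha(G)$, $\kappa(G) < \delta(G)$ and $|S \setminus I| \leq 1$, then $G \in \mathcal{G}_{2}(3,3)$.
   Context: All graphs are finite, simple and connected. A set $D \subseteq V(G)$ is a connected dominating set of $G$ if every vertex of $G$ is in $D$ or adjacent to a vertex of $D$, and $G[D]$ is connected; $\gamma_{c}(G)$ is the minimum size of such a set. For non-adjacent $u,v$, $G+uv$ is $G$ with edge $uv$ added. $G$ is $3$-$\gamma_{c}$-critical if $\gamma_{c}(G)=3$ and $\gamma_{c}(G+uv)<3$ for every pair of non-adjacent vertices $u,v$. $\alpha(G)$ is the independence number, $\delta(G)$ the minimum degree, $\kappa(G)$ the connectivity; a vertex cut set is a set $S$ with $G-S$ disconnected, and a minimum one has size $\kappa(G)$. The class $\mathcal{G}_{2}(3,3)$: take integers $j_1, j_2 \geq 3$, pairwise disjoint vertex sets $J_1, J_2$ with $|J_1| = j_1$, $|J_2| = j_2$, two distinct vertices $u_1, u_2 \in J_2$, and three further vertices $w, w_1, v_1$. Form the graph on $J_1 \cup J_2 \cup \{w, w_1, v_1\}$ whose edges are exactly: all edges inside $J_1$, all edges inside $J_2$, $v_1$ joined to every vertex of $J_1$, $w_1$ joined to every vertex of $J_1 \cup (J_2 \setminus \{u_1\}) \cup \{w\}$, and $w$ joined to every vertex of $J_1 \cup (J_2 \setminus \{u_2\}) \cup \{w_1\}$. $\mathcal{G}_{2}(3,3)$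 is the class of all graphs (up to isomorphism) obtained this way. -}

module Defs where

open import Data.Nat using (ℕ; _≤_; _<_; _⊓_)
open import Data.Bool using (Bool; true; false; _∨_; _∧_)
open import Data.Fin using (Fin; _≟_)
open import Data.Fin.Subset using (Subset; _∈_; _∉_; ∣_∣; ⊤)
open import Data.Vec using (tabulate)
open import Data.List using (List; foldr; allFin)
open import Data.Product using (Σ; _×_; ∃; ∃-syntax)
open import Data.Sum using (_⊎_)
open import Relation.Nullary using (¬_)
open import Relation.Nullary.Decidable using (⌊_⌋)
open import Relation.Binary.PropositionalEquality using (_≡_; _≢_)

Graph : ℕ → Set
Graph n = Fin n → Fin n → Bool

module _ {n : ℕ} (G : Graph n) where

  IsSimple : Set
  IsSimple = (∀ x y → G x y ≡ G y x) × (∀ x → G x x ≡ false)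

  data Reach (P : Subset n) : Fin n → Fin n → Set where
    here : ∀ {x} → x ∈ P → Reach P x x
    step : ∀ {x z y} → x ∈ P → G x z ≡ true → Reach P z y → Reach P x y

  IsConnected : Set
  IsConnected = ∀ x y → Reach ⊤ x y

  IsDominating : Subset n → Set
  IsDominating D = ∀ x → x ∈ D ⊎ (∃[ y ] (y ∈ D × G x y ≡ true))

  InducesConnected : Subset n → Set
  InducesConnected D = ∀ x y → x ∈ D → y ∈ D → Reach D x y

  IsCDS : Subset n → Set
  IsCDS D = IsDominating D × InducesConnected D

  ConnDomNumber : ℕ → Set
  ConnDomNumber k = (∃[ D ] (IsCDS D × ∣ D ∣ ≡ k)) × (∀ D → IsCDS D → k ≤ ∣ D ∣)

  IsIndependent : Subset n → Set
  IsIndependent I = ∀ x y → x ∈ I → y ∈ I → G x y ≡ false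

  IsMaxIndependent : Subset n → Set
  IsMaxIndependent I = IsIndependent I × (∀ J → IsIndependent J → ∣ J ∣ ≤ ∣ I ∣)

  IsVertexCut : Subset n → Set
  IsVertexCut S = ∃[ x ] ∃[ y ] (x ∉ S × y ∉ S × ¬ Reach (Data.Fin.Subset.∁ S) x y)

  IsMinVertexCut : Subset n → Set
  IsMinVertexCut S = IsVertexCut S × (∀ T → IsVertexCut T → ∣ S ∣ ≤ ∣ T ∣)

  degree : Fin n → ℕ
  degree v = ∣ tabulate (G v) ∣

  -- minimum degree δ(G) (starting value n exceeds every degree of a simple graph)
  minDegree : ℕ
  minDegree = foldr (λ v m → degree v ⊓ m) n (allFin n)

addEdge : ∀ {n} → Graph n → Fin n → Fin n → Graph n
addEdge G u v x y = G x y ∨ (⌊ x ≟ u ⌋ ∧ ⌊ y ≟ v ⌋) ∨ (⌊ x ≟ v ⌋ ∧ ⌊ y ≟ u ⌋)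

Is3Critical : ∀ {n} → Graph n → Set
Is3Critical {n} G =
  ConnDomNumber G 3 ×
  (∀ (u v : Fin n) → u ≢ v → G u v ≡ false →
     ∃[ k ] (k < 3 × ConnDomNumber (addEdge G u v) k))

module _ {n : ℕ} (G : Graph n) where

  -- directed description of the edge list; an edge xy exists iff ListedEdge x y or ListedEdge y x
  ListedEdge : (J₁ J₂ : Subset n) (u₁ u₂ w w₁ v₁ : Fin n) → Fin n → Fin n → Set
  ListedEdge J₁ J₂ u₁ u₂ w w₁ v₁ x y =
    (x ∈ J₁ × y ∈ J₁) ⊎
    (x ∈ J₂ × y ∈ J₂) ⊎
    (x ≡ v₁ × y ∈ J₁) ⊎
    (x ≡ w₁ × (y ∈ J₁ ⊎ (y ∈ J₂ × y ≢ u₁) ⊎ y ≡ w)) ⊎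
    (x ≡ w × (y ∈ J₁ ⊎ (y ∈ J₂ × y ≢ u₂) ⊎ y ≡ w₁))

  record InG233 : Set where
    field
      J₁ J₂ : Subset n
      u₁ u₂ w w₁ v₁ : Fin n
      |J₁|≥3 : 3 ≤ ∣ J₁ ∣
      |J₂|≥3 : 3 ≤ ∣ J₂ ∣
      u₁∈J₂ : u₁ ∈ J₂
      u₂∈J₂ : u₂ ∈ J₂
      u₁≢u₂ : u₁ ≢ u₂
      J₁∩J₂ : ∀ x → x ∈ J₁ → x ∉ J₂
      w∉J₁ : w ∉ J₁
      w∉J₂ : w ∉ J₂
      w₁∉J₁ : w₁ ∉ J₁
      w₁∉J₂ : w₁ ∉ J₂
      v₁∉J₁ : v₁ ∉ J₁
      v₁∉J₂ : v₁ ∉ J₂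
      w≢w₁ : w ≢ w₁
      w≢v₁ : w ≢ v₁
      w₁≢v₁ : w₁ ≢ v₁
      cover : ∀ x → x ∈ J₁ ⊎ x ∈ J₂ ⊎ x ≡ w ⊎ x ≡ w₁ ⊎ x ≡ v₁
      edges : ∀ x y → x ≢ y →
        (G x y ≡ true → ListedEdge J₁ J₂ u₁ u₂ w w₁ v₁ x y ⊎ ListedEdge J₁ J₂ u₁ u₂ w w₁ v₁ y x) ×
        (ListedEdge J₁ J₂ u₁ u₂ w w₁ v₁ x y ⊎ ListedEdge J₁ J₂ u₁ u₂ w w₁ v₁ y x → G x y ≡ true)

{-# OPTIONS --safe #-}

-- For non-adjacent u, v, criticality gives a dominating pair {u, v} of G, or a
-- neighbour y of one of them, say u, such that {u, y} dominates everything but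
-- v (written u ⇒ v). Let A and B be the two sides of G - S. As κ < δ, each side
-- has no isolated vertex, so a vertex p ∈ A without neighbours in S must
-- dominate A, and no such p ∈ A and q ∈ B exist together; in particular
-- |S| ≥ 2. On an independent set of size at least 3 the relation ⇒ is a
-- tournament whose witnesses y are adjacent to all of I but v. This excludes
-- S ⊆ I, and two vertices of I on the same side. Otherwise S has one vertex c
-- outside I, and for p ∈ A ∩ I, q ∈ B ∩ I with p ⇒ q the witness is c. Then
-- S = {c, s}, and all adjacencies are forced: J₁ = B - q, J₂ = A, w = s,
-- w₁ = c, v₁ = q, u₂ = p, and u₁ is the unique non-neighbour of c in A.
module Submission where

open import Defs
open import Data.Nat using (ℕ; _≤_; _<_; _+_; suc; s≤s; z≤n; _⊓_)
open import Data.Nat.Properties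
  using (≤-trans; ≤-reflexive; ≤-pred; <⇒≱; n<1+n; n≤1+n; m⊓n≤m; m⊓n≤n; +-comm)
import Data.Bool as Bool
open import Data.Bool using (true; false)
open import Data.Bool.Properties using (¬-not)
open import Data.Fin using (Fin; _≟_)
open import Data.Fin.Properties using (any?)
open import Data.Fin.Subset
  using (Subset; inside; outside; ∣_∣; _─_; _-_; _∈_; _∉_; _⊆_; _⊃_; _∪_; ∁; ⁅_⁆; ⊤)
open import Data.Fin.Subset.Properties
open import Data.Fin.Subset.Induction using (Acc; acc; ⊃-wellFounded)
open import Data.List using (_∷_; foldr; allFin)
open import Data.List.Membership.Propositional using () renaming (_∈_ to _∈ˡ_)
open import Data.List.Membership.Propositional.Properties using (∈-allFin)
open import Data.List.Relation.Unary.Any using () renaming (here to hereˡ; there to thereˡ)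
open import Data.Vec using (tabulate; _∷_; here; there)
open import Data.Vec.Properties using (lookup∘tabulate; []=⇒lookup)
open import Data.Product using (_×_; _,_; ∃-syntax; proj₁; proj₂)
open import Data.Sum using (_⊎_; inj₁; inj₂; [_,_]′)
import Data.Sum as Sum
open import Data.Empty using (⊥; ⊥-elim)
open import Function using (_∘_)
open import Relation.Nullary using (¬_; Dec; yes; no; contradiction)
open import Relation.Nullary.Decidable using (¬?; _×-dec_; decidable-stable)
open import Relation.Binary.PropositionalEquality
  using (_≡_; _≢_; refl; sym; trans; cong; subst; ≢-sym)

-- Cardinalities of subsets

x∈p-y⇒x≢y : ∀ {n} {x y : Fin n} (p : Subset n) → x ∈ p - y → x ≢ y
x∈p-y⇒x≢y {y = y} p x∈ refl = go p ⁅ y ⁆ x∈ (x∈⁅x⁆ y)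
  where
  go : ∀ {n} {x : Fin n} (p q : Subset n) → x ∈ p ─ q → x ∉ q
  go (inside ∷ p) (inside ∷ q) () here
  go (outside ∷ p) (inside ∷ q) () here
  go (_ ∷ p) (inside ∷ q) (there h) (there h′) = go p q h h′
  go (_ ∷ p) (outside ∷ q) (there h) (there h′) = go p q h h′

∣p∣≤1+∣p-x∣ : ∀ {n} (p : Subset n) (x : Fin n) → ∣ p ∣ ≤ suc ∣ p - x ∣
∣p∣≤1+∣p-x∣ (inside ∷ p) Fin.zero = s≤s (≤-reflexive (cong ∣_∣ (sym (p─⊥≡p p))))
∣p∣≤1+∣p-x∣ (outside ∷ p) Fin.zero =
  ≤-trans (≤-reflexive (cong ∣_∣ (sym (p─⊥≡p p)))) (n≤1+n _)
∣p∣≤1+∣p-x∣ (inside ∷ p) (Fin.suc x) = s≤s (∣p∣≤1+∣p-x∣ p x)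
∣p∣≤1+∣p-x∣ (outside ∷ p) (Fin.suc x) = ∣p∣≤1+∣p-x∣ p x

module _ {n : ℕ} where

  p-x⊆q⇒∣p∣≤1+∣q∣ : ∀ {p q : Subset n} {x} → (∀ z → z ∈ p → z ≢ x → z ∈ q) → ∣ p ∣ ≤ suc ∣ q ∣
  p-x⊆q⇒∣p∣≤1+∣q∣ {p} {q} {x} h =
    ≤-trans (∣p∣≤1+∣p-x∣ p x)
      (s≤s (p⊆q⇒∣p∣≤∣q∣ λ {z} z∈ → h z (p─q⊆p p ⁅ x ⁆ z∈) (x∈p-y⇒x≢y p z∈)))

  ∣p∣<∣q∣⇒∃∈∉ : ∀ {p q : Subset n} → ∣ p ∣ < ∣ q ∣ → ∃[ x ] (x ∈ q × x ∉ p)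
  ∣p∣<∣q∣⇒∃∈∉ {p} {q} lt with any? (λ x → (x ∈? q) ×-dec ¬? (x ∈? p))
  ... | yes found = found
  ... | no none = contradiction
    (p⊆q⇒∣p∣≤∣q∣ λ {x} x∈q → decidable-stable (x ∈? p) λ x∉p → none (x , x∈q , x∉p))
    (<⇒≱ lt)

  ∣p∣≤1⇒x≡y : ∀ {p : Subset n} {x y} → ∣ p ∣ ≤ 1 → x ∈ p → y ∈ p → y ≡ x
  ∣p∣≤1⇒x≡y {p} {x} {y} le x∈ y∈ = decidable-stable (y ≟ x) λ y≢x →
    <⇒≱ (≤-trans (s≤s (≤-trans (s≤s z≤n) (x∈p⇒∣p-x∣<∣p∣ (x∈p∧x≢y⇒x∈p-y y∈ y≢x))))
                 (x∈p⇒∣p-x∣<∣p∣ x∈)) le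

  ∣p∣≤2⇒x≡a⊎x≡b : ∀ {p : Subset n} {a b} → ∣ p ∣ ≤ 2 → a ∈ p → b ∈ p → a ≢ b →
    ∀ x → x ∈ p → x ≡ a ⊎ x ≡ b
  ∣p∣≤2⇒x≡a⊎x≡b {p} {a} {b} le a∈ b∈ a≢b x x∈ with x ≟ a
  ... | yes x≡a = inj₁ x≡a
  ... | no x≢a = inj₂ (∣p∣≤1⇒x≡y
    (≤-pred (≤-trans (x∈p⇒∣p-x∣<∣p∣ a∈) le))
    (x∈p∧x≢y⇒x∈p-y b∈ (≢-sym a≢b)) (x∈p∧x≢y⇒x∈p-y x∈ x≢a))

-- Domination by adjacent pairs

module Domination {n : ℕ} (G : Graph n) where

  infix 4 _~_ _▷_ _⇒_

  _~_ : Fin n → Fin n → Set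
  x ~ y = G x y ≡ true

  _~?_ : ∀ x y → Dec (x ~ y)
  x ~? y = G x y Bool.≟ true

  _▷_ : Fin n → Fin n → Set
  u ▷ x = x ≡ u ⊎ u ~ x

  Dom : Fin n → Fin n → Set
  Dom u v = ∀ x → u ▷ x ⊎ v ▷ x

  -- The edge `uy` dominates `G + uv`, where `v` is reached through `u`, but leaves `v` undominated
  -- from `y` in `G`.
  _⇒_ : Fin n → Fin n → Set
  u ⇒ v = ∃[ y ] (u ~ y × ¬ y ~ v × (∀ x → x ≢ v → u ▷ x ⊎ y ▷ x))

  nbrs∈ : ∀ {x y} → y ∈ tabulate (G x) → x ~ y
  nbrs∈ {x} {y} y∈ = trans (sym (lookup∘tabulate (G x) y)) ([]=⇒lookup y∈)

  minDegree≤ : ∀ x → minDegree G ≤ degree G x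
  minDegree≤ x = go (allFin n) (∈-allFin x)
    where
    go : ∀ xs → x ∈ˡ xs → foldr (λ v m → degree G v ⊓ m) n xs ≤ degree G x
    go (_ ∷ xs) (hereˡ refl) = m⊓n≤m _ _
    go (_ ∷ xs) (thereˡ x∈) = ≤-trans (m⊓n≤n _ _) (go xs x∈)

  Reach-start : ∀ {P x y} → Reach G P x y → x ∈ P
  Reach-start (here x∈) = x∈
  Reach-start (step x∈ _ _) = x∈

  Reach-snoc : ∀ {P x y z} → Reach G P x y → y ~ z → z ∈ P → Reach G P x z
  Reach-snoc (here y∈) e z∈ = step y∈ e (here z∈)
  Reach-snoc (step x∈ e r) e′ z∈ = step x∈ e (Reach-snoc r e′ z∈)

  -- The interface through which `Sides` and `IndependentSet` use simplicity and criticality;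
  -- connected dominating sets do not occur there.
  record PairCritical : Set where
    field
      ~-sym : ∀ {x y} → x ~ y → y ~ x
      ~-irrefl : ∀ {x y} → x ~ y → x ≢ y
      no-dominating-edge : ∀ {u y} → u ~ y → ¬ Dom u y
      critical-pair : ∀ u v → u ≢ v → ¬ u ~ v → Dom u v ⊎ u ⇒ v ⊎ v ⇒ u

  -- Symmetric in `A` and `B`, so that `swap` carries every lemma to the other side.
  record Separation (S : Subset n) : Set where
    field
      A B : Subset n
      locate : ∀ x → x ∈ S ⊎ x ∈ A ⊎ x ∈ B
      A∩S : ∀ {x} → x ∈ A → x ∉ S
      B∩S : ∀ {x} → x ∈ B → x ∉ S
      A∩B : ∀ {x} → x ∈ A → x ∉ B
      A≁B : ∀ {x y} → x ∈ A → y ∈ B → ¬ x ~ y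
      nbrA : ∀ {x} → x ∈ A → ∃[ y ] (y ∈ A × x ~ y)
      nbrB : ∀ {x} → x ∈ B → ∃[ y ] (y ∈ B × x ~ y)
      S~A : ∀ {s} → s ∈ S → ∃[ y ] (y ∈ A × s ~ y)
      S~B : ∀ {s} → s ∈ S → ∃[ y ] (y ∈ B × s ~ y)
      someA : ∃[ x ] x ∈ A
      someB : ∃[ x ] x ∈ B

-- From connected dominating sets of `G + uv` to pairs in `G`

module Criticality {n : ℕ} (G : Graph n) (simple : IsSimple G)
  (nbr : ∀ x → ∃[ y ] G x y ≡ true) (critical : Is3Critical G) where

  open Domination G

  private
    ~-sym : ∀ {x y} → x ~ y → y ~ x
    ~-sym {x} {y} e = trans (proj₁ simple y x) e

    ~-irrefl : ∀ {x y} → x ~ y → x ≢ y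
    ~-irrefl {x} e refl with trans (sym e) (proj₂ simple x)
    ... | ()

  -- Such an edge would form a connected dominating set with at most two vertices.
  no-dominating-edge : ∀ {u y} → u ~ y → ¬ Dom u y
  no-dominating-edge {u} {y} u~y dom = <⇒≱ (n<1+n 2)
    (≤-trans (proj₂ (proj₁ critical) D (dominating , connected)) ∣D∣≤2)
    where
    D : Subset n
    D = ⁅ u ⁆ ∪ ⁅ y ⁆
    u∈D : u ∈ D
    u∈D = x∈p∪q⁺ (inj₁ (x∈⁅x⁆ u))
    y∈D : y ∈ D
    y∈D = x∈p∪q⁺ (inj₂ (x∈⁅x⁆ y))
    elements : ∀ {x} → x ∈ D → x ≡ u ⊎ x ≡ y
    elements x∈ = Sum.map (x∈⁅y⁆⇒x≡y u) (x∈⁅y⁆⇒x≡y y) (x∈p∪q⁻ _ _ x∈)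
    ∣D∣≤2 : ∣ D ∣ ≤ 2
    ∣D∣≤2 = ≤-trans (p-x⊆q⇒∣p∣≤1+∣q∣ {q = ⁅ y ⁆} {x = u}
        λ z z∈ z≢u → [ ⊥-elim ∘ z≢u , (λ { refl → x∈⁅x⁆ y }) ]′ (elements z∈))
      (≤-reflexive (cong suc (∣⁅x⁆∣≡1 y)))
    dominating : IsDominating G D
    dominating x with dom x
    ... | inj₁ (inj₁ refl) = inj₁ u∈D
    ... | inj₁ (inj₂ e) = inj₂ (u , u∈D , ~-sym e)
    ... | inj₂ (inj₁ refl) = inj₁ y∈D
    ... | inj₂ (inj₂ e) = inj₂ (y , y∈D , ~-sym e)
    connected : InducesConnected G D
    connected a b a∈ b∈ with elements a∈ | elements b∈
    ... | inj₁ refl | inj₁ refl = here a∈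
    ... | inj₁ refl | inj₂ refl = step a∈ u~y (here b∈)
    ... | inj₂ refl | inj₁ refl = step a∈ (~-sym u~y) (here b∈)
    ... | inj₂ refl | inj₂ refl = here a∈

  private
    no-dominating-vertex : ∀ {u} → ¬ (∀ x → u ▷ x)
    no-dominating-vertex {u} dom = no-dominating-edge (proj₂ (nbr u)) (inj₁ ∘ dom)

    module SmallCDS (H : Graph n) (D : Subset n) (cds : IsCDS H D) (∣D∣≤2 : ∣ D ∣ ≤ 2) where

      -- A walk inside `D` first leaves `a` towards `b`; steps from `a` to itself are skipped by
      -- recursion.
      first-edge : ∀ {a b x} → (∀ z → z ∈ D → z ≡ a ⊎ z ≡ b) → Reach H D x b → x ≡ a → a ≢ b →
        H a b ≡ true
      first-edge D⊆ (here _) x≡a a≢b = contradiction (sym x≡a) a≢b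
      first-edge D⊆ (step {z = z} x∈ e r) refl a≢b
        with D⊆ z (Domination.Reach-start H r)
      ... | inj₁ z≡a = first-edge D⊆ r z≡a a≢b
      ... | inj₂ refl = e

      shape : ∀ {a} → a ∈ D → (∀ z → z ∈ D → z ≡ a) ⊎
        ∃[ b ] (b ∈ D × a ≢ b × H a b ≡ true × (∀ z → z ∈ D → z ≡ a ⊎ z ≡ b))
      shape {a} a∈ with any? (λ z → (z ∈? D) ×-dec ¬? (z ≟ a))
      ... | no none = inj₁ λ z z∈ → decidable-stable (z ≟ a) λ z≢a → none (z , z∈ , z≢a)
      ... | yes (b , b∈ , b≢a) =
        inj₂ (b , b∈ , ≢-sym b≢a , first-edge D⊆ (proj₂ cds a b a∈ b∈) refl (≢-sym b≢a) , D⊆)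
        where
        D⊆ : ∀ z → z ∈ D → z ≡ a ⊎ z ≡ b
        D⊆ = ∣p∣≤2⇒x≡a⊎x≡b ∣D∣≤2 a∈ b∈ (≢-sym b≢a)

      -- If `D` is `{u}`, then `u` and a neighbour of `v` form a dominating edge of `G`. If `D` is
      -- `{u, v}`, the pair dominates `G`, and any other second vertex `b` witnesses `u ⇒ v`. The
      -- assumption on edges of `H` is symmetric in `u` and `v`, so one argument serves both
      -- endpoints.
      endpoint∈D : ∀ {u v} →
        (∀ {x y} → H x y ≡ true → x ~ y ⊎ (x ≡ u × y ≡ v) ⊎ (x ≡ v × y ≡ u)) →
        u ≢ v → ¬ u ~ v → u ∈ D → Dom u v ⊎ u ⇒ v
      endpoint∈D {u} {v} edge u≢v u≁v u∈ with shape u∈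
      ... | inj₁ D⊆u = ⊥-elim (no-dominating-edge u~t dom)
        where
        t = proj₁ (nbr v)
        v~t = proj₂ (nbr v)
        but-v : ∀ x → x ≢ v → u ▷ x
        but-v x x≢v with proj₁ cds x
        ... | inj₁ x∈ = inj₁ (D⊆u x x∈)
        ... | inj₂ (y , y∈ , e) with D⊆u y y∈ | edge e
        ... | refl | inj₁ x~u = inj₂ (~-sym x~u)
        ... | refl | inj₂ (inj₁ (x≡u , _)) = inj₁ x≡u
        ... | refl | inj₂ (inj₂ (x≡v , _)) = contradiction x≡v x≢v
        u~t : u ~ t
        u~t with but-v t (≢-sym (~-irrefl v~t))
        ... | inj₁ t≡u = contradiction (~-sym (subst (v ~_) t≡u v~t)) u≁v
        ... | inj₂ e = e
        dom : Dom u t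
        dom x with x ≟ v
        ... | yes refl = inj₂ (inj₂ (~-sym v~t))
        ... | no x≢v = inj₁ (but-v x x≢v)
      ... | inj₂ (b , b∈ , u≢b , Hub , D⊆) with b ≟ v
      ... | yes refl = inj₁ dom
        where
        dom : Dom u v
        dom x with proj₁ cds x
        ... | inj₁ x∈ = Sum.map inj₁ inj₁ (D⊆ x x∈)
        ... | inj₂ (y , y∈ , e) with D⊆ y y∈ | edge e
        ... | inj₁ refl | inj₁ x~u = inj₁ (inj₂ (~-sym x~u))
        ... | inj₂ refl | inj₁ x~v = inj₂ (inj₂ (~-sym x~v))
        ... | _ | inj₂ (inj₁ (x≡u , _)) = inj₁ (inj₁ x≡u)
        ... | _ | inj₂ (inj₂ (x≡v , _)) = inj₂ (inj₁ x≡v)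
      ... | no b≢v = inj₂ (b , u~b , b≁v , but-v)
        where
        u~b : u ~ b
        u~b with edge Hub
        ... | inj₁ e = e
        ... | inj₂ (inj₁ (_ , b≡v)) = contradiction b≡v b≢v
        ... | inj₂ (inj₂ (u≡v , _)) = contradiction u≡v u≢v
        but-v : ∀ x → x ≢ v → u ▷ x ⊎ b ▷ x
        but-v x x≢v with proj₁ cds x
        ... | inj₁ x∈ = Sum.map inj₁ inj₁ (D⊆ x x∈)
        ... | inj₂ (y , y∈ , e) with D⊆ y y∈ | edge e
        ... | inj₁ refl | inj₁ x~u = inj₁ (inj₂ (~-sym x~u))
        ... | inj₂ refl | inj₁ x~b = inj₂ (inj₂ (~-sym x~b))
        ... | _ | inj₂ (inj₁ (x≡u , _)) = inj₁ (inj₁ x≡u)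
        ... | _ | inj₂ (inj₂ (x≡v , _)) = contradiction x≡v x≢v
        -- Otherwise the edge `ub` would dominate all of `G`.
        b≁v : ¬ b ~ v
        b≁v b~v = no-dominating-edge u~b λ x → dom x (x ≟ v)
          where
          dom : ∀ x → Dec (x ≡ v) → u ▷ x ⊎ b ▷ x
          dom x (yes refl) = inj₂ (inj₂ b~v)
          dom x (no x≢v) = but-v x x≢v

      -- The new edge has no end in `D`, so every edge used by `D` belongs to `G`, and `D` would be
      -- a connected dominating set of `G` with at most two vertices. The vertex dominating `u`
      -- shows that `D` is nonempty.
      endpoint-needed : ∀ {u v} →
        (∀ {x y} → H x y ≡ true → x ~ y ⊎ (x ≡ u × y ≡ v) ⊎ (x ≡ v × y ≡ u)) →
        u ∉ D → v ∉ D → ⊥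
      endpoint-needed {u} {v} edge u∉ v∉ with proj₁ cds u
      ... | inj₁ u∈ = u∉ u∈
      ... | inj₂ (a , a∈ , _) = cases (shape a∈)
        where
        old-edge : ∀ {x y} → y ∈ D → H x y ≡ true → x ~ y
        old-edge y∈ e with edge e
        ... | inj₁ e′ = e′
        ... | inj₂ (inj₁ (_ , refl)) = contradiction y∈ v∉
        ... | inj₂ (inj₂ (_ , refl)) = contradiction y∈ u∉
        cases : _ → ⊥
        cases (inj₁ D⊆a) = no-dominating-vertex dom
          where
          dom : ∀ x → a ▷ x
          dom x with proj₁ cds x
          ... | inj₁ x∈ = inj₁ (D⊆a x x∈)
          ... | inj₂ (y , y∈ , e) with D⊆a y y∈
          ... | refl = inj₂ (~-sym (old-edge y∈ e))
        cases (inj₂ (b , b∈ , _ , Hab , D⊆)) = no-dominating-edge (old-edge b∈ Hab) dom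
          where
          dom : Dom a b
          dom x with proj₁ cds x
          ... | inj₁ x∈ = Sum.map inj₁ inj₁ (D⊆ x x∈)
          ... | inj₂ (y , y∈ , e) with D⊆ y y∈
          ... | inj₁ refl = inj₁ (inj₂ (~-sym (old-edge y∈ e)))
          ... | inj₂ refl = inj₂ (inj₂ (~-sym (old-edge y∈ e)))

    addEdge⁻ : ∀ u v {x y} → addEdge G u v x y ≡ true →
      x ~ y ⊎ (x ≡ u × y ≡ v) ⊎ (x ≡ v × y ≡ u)
    addEdge⁻ u v {x} {y} e with G x y
    ... | true = inj₁ refl
    ... | false with x ≟ u | y ≟ v | x ≟ v | y ≟ u
    ... | yes x≡u | yes y≡v | _ | _ = inj₂ (inj₁ (x≡u , y≡v))
    ... | yes _ | no _ | yes x≡v | yes y≡u = inj₂ (inj₂ (x≡v , y≡u))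
    ... | no _ | _ | yes x≡v | yes y≡u = inj₂ (inj₂ (x≡v , y≡u))
    addEdge⁻ u v () | false | yes _ | no _ | yes _ | no _
    addEdge⁻ u v () | false | yes _ | no _ | no _ | _
    addEdge⁻ u v () | false | no _ | _ | yes _ | no _
    addEdge⁻ u v () | false | no _ | _ | no _ | _

    critical-pair : ∀ u v → u ≢ v → ¬ u ~ v → Dom u v ⊎ u ⇒ v ⊎ v ⇒ u
    critical-pair u v u≢v u≁v with proj₂ critical u v u≢v (¬-not u≁v)
    ... | k , s≤s k≤2 , (D , cds , refl) , _ = cases (u ∈? D) (v ∈? D)
      where
      open SmallCDS (addEdge G u v) D cds k≤2
      cases : Dec (u ∈ D) → Dec (v ∈ D) → Dom u v ⊎ u ⇒ v ⊎ v ⇒ u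
      cases (yes u∈) _ = Sum.map₂ inj₁ (endpoint∈D (addEdge⁻ u v) u≢v u≁v u∈)
      cases (no _) (yes v∈) =
        Sum.map (λ dom x → Sum.swap (dom x)) inj₂
          (endpoint∈D (Sum.map₂ Sum.swap ∘ addEdge⁻ u v) (≢-sym u≢v) (u≁v ∘ ~-sym) v∈)
      cases (no u∉) (no v∉) = ⊥-elim (endpoint-needed (addEdge⁻ u v) u∉ v∉)

  pairCritical : PairCritical
  pairCritical = record
    { ~-sym = ~-sym ; ~-irrefl = ~-irrefl
    ; no-dominating-edge = no-dominating-edge ; critical-pair = critical-pair }

-- Separating the graph along a minimum vertex cut

module MinCut {n : ℕ} (G : Graph n) (S : Subset n) (simple : IsSimple G)
  (minCut : IsMinVertexCut G S) (∣S∣<degree : ∀ x → ∣ S ∣ < degree G x) where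

  open Domination G

  private
    ~-sym : ∀ {x y} → x ~ y → y ~ x
    ~-sym {x} {y} e = trans (proj₁ simple y x) e

  Closed : Subset n → Set
  Closed A = ∀ {x y} → x ∈ A → x ~ y → y ∉ S → y ∈ A

  -- Starting from `{x}`, vertices outside `S` adjacent to the current set are added one at a time;
  -- this stops because the vertex set is finite. Reachability thereby becomes decidable membership
  -- in a subset.
  component : ∀ {x} → x ∉ S →
    ∃[ A ] (x ∈ A × (∀ z → z ∈ A → Reach G (∁ S) x z) × Closed A)
  component {x} x∉S = grow ⁅ x ⁆ (⊃-wellFounded ⁅ x ⁆) (x∈⁅x⁆ x)
    λ z z∈ → subst (Reach G (∁ S) x) (sym (x∈⁅y⁆⇒x≡y x z∈)) (here (x∉p⇒x∈∁p x∉S))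
    where
    grow : ∀ A → Acc _⊃_ A → x ∈ A → (∀ z → z ∈ A → Reach G (∁ S) x z) →
      ∃[ A ] (x ∈ A × (∀ z → z ∈ A → Reach G (∁ S) x z) × Closed A)
    grow A (acc larger) x∈A reach
      with any? (λ z → ¬? (z ∈? S) ×-dec ¬? (z ∈? A) ×-dec
                  any? (λ a → (a ∈? A) ×-dec (a ~? z)))
    ... | no none = A , x∈A , reach , λ {a} {z} a∈ e z∉S →
      decidable-stable (z ∈? A) λ z∉A → none (z , z∉S , z∉A , a , a∈ , e)
    ... | yes (z , z∉S , z∉A , a , a∈ , e) =
      grow (A ∪ ⁅ z ⁆)
        (larger (p⊆p∪q ⁅ z ⁆ , z , x∈p∪q⁺ (inj₂ (x∈⁅x⁆ z)) , z∉A))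
        (p⊆p∪q ⁅ z ⁆ x∈A)
        λ t t∈ → [ reach t
                 , (λ t∈z → subst (Reach G (∁ S) x) (sym (x∈⁅y⁆⇒x≡y z t∈z))
                              (Reach-snoc (reach a a∈) e (x∉p⇒x∈∁p z∉S)))
                 ]′ (x∈p∪q⁻ A ⁅ z ⁆ t∈)

  Reach-Closed : ∀ {T A : Subset n} {x y} →
    (∀ {u v} → u ∈ A → u ~ v → v ∉ T → v ∈ A) → x ∈ A → Reach G (∁ T) x y → y ∈ A
  Reach-Closed closed x∈ (here _) = x∈
  Reach-Closed closed x∈ (step _ e r) =
    Reach-Closed closed (closed x∈ e (x∈∁p⇒x∉p (Reach-start r))) r

  -- A vertex of S without a neighbour on some side can be dropped from the cut.
  cut-touches : ∀ {A s x y} → (∀ {u v} → u ∈ A → u ~ v → v ∉ S → v ∈ A) →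
    (∀ {u} → u ∈ A → u ∉ S) → x ∈ A → y ∉ S → y ∉ A → s ∈ S → ∃[ a ] (a ∈ A × s ~ a)
  cut-touches {A} {s} {x} {y} closed A∩S x∈A y∉S y∉A s∈S
    with any? (λ a → (a ∈? A) ×-dec (s ~? a))
  ... | yes found = found
  ... | no none = contradiction (proj₂ minCut (S - s) cut) (<⇒≱ (x∈p⇒∣p-x∣<∣p∣ s∈S))
    where
    closed′ : ∀ {u v} → u ∈ A → u ~ v → v ∉ S - s → v ∈ A
    closed′ {u} {v} u∈ e v∉ with v ≟ s
    ... | yes refl = contradiction (u , u∈ , ~-sym e) none
    ... | no v≢s = closed u∈ e λ v∈ → v∉ (x∈p∧x≢y⇒x∈p-y v∈ v≢s)
    ∉S-s : ∀ {z} → z ∉ S → z ∉ S - s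
    ∉S-s z∉ z∈ = z∉ (p─q⊆p S ⁅ s ⁆ z∈)
    cut : IsVertexCut G (S - s)
    cut = x , y , ∉S-s (A∩S x∈A) , ∉S-s y∉S , λ r → y∉A (Reach-Closed closed′ x∈A r)

  -- There are more neighbours of `x` than elements of `S`.
  nbr-outside-S : ∀ x → ∃[ y ] (x ~ y × y ∉ S)
  nbr-outside-S x with ∣p∣<∣q∣⇒∃∈∉ (∣S∣<degree x)
  ... | y , y∈ , y∉S = y , nbrs∈ y∈ , y∉S

  -- `A` is one component of `G - S` and `B` is the union of the others. The neighbours within a
  -- side come from κ < δ, those of `S` in each side from minimality of the cut.
  separation : Separation S
  separation with proj₁ minCut
  ... | x , y , x∉S , y∉S , unreachable with component x∉S
  ... | A , x∈A , reach , closed = record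
    { A = A ; B = B ; locate = locate ; A∩S = A∩S ; B∩S = B∩S ; A∩B = A∩B
    ; A≁B = λ a∈ b∈ e → A∩B (closed a∈ e (B∩S b∈)) b∈
    ; nbrA = λ {a} a∈ → let z , e , z∉S = nbr-outside-S a in z , closed a∈ e z∉S , e
    ; nbrB = λ {b} b∈ → let z , e , z∉S = nbr-outside-S b in z , closedB b∈ e z∉S , e
    ; S~A = cut-touches closed A∩S x∈A y∉S y∉A
    ; S~B = cut-touches closedB B∩S y∈B x∉S (A∩B x∈A)
    ; someA = x , x∈A
    ; someB = y , y∈B }
    where
    B : Subset n
    B = ∁ (S ∪ A)
    y∉A : y ∉ A
    y∉A y∈ = unreachable (reach y y∈)
    ∈B : ∀ {z} → z ∉ S → z ∉ A → z ∈ B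
    ∈B z∉S z∉A = x∉p⇒x∈∁p λ z∈ → [ z∉S , z∉A ]′ (x∈p∪q⁻ S A z∈)
    y∈B : y ∈ B
    y∈B = ∈B y∉S y∉A
    B∩S : ∀ {z} → z ∈ B → z ∉ S
    B∩S z∈ z∈S = x∈∁p⇒x∉p z∈ (x∈p∪q⁺ (inj₁ z∈S))
    A∩B : ∀ {z} → z ∈ A → z ∉ B
    A∩B z∈A z∈ = x∈∁p⇒x∉p z∈ (x∈p∪q⁺ (inj₂ z∈A))
    A∩S : ∀ {z} → z ∈ A → z ∉ S
    A∩S {z} z∈ = x∈∁p⇒x∉p (reach-end (reach z z∈))
      where
      reach-end : ∀ {P u v} → Reach G P u v → v ∈ P
      reach-end (here v∈) = v∈
      reach-end (step _ _ r) = reach-end r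
    closedB : ∀ {u v} → u ∈ B → u ~ v → v ∉ S → v ∈ B
    closedB u∈ e v∉S = ∈B v∉S λ v∈A → A∩B (closed v∈A (~-sym e) (B∩S u∈)) u∈
    locate : ∀ z → z ∈ S ⊎ z ∈ A ⊎ z ∈ B
    locate z with z ∈? S | z ∈? A
    ... | yes z∈ | _ = inj₁ z∈
    ... | no _ | yes z∈ = inj₂ (inj₁ z∈)
    ... | no z∉S | no z∉A = inj₂ (inj₂ (∈B z∉S z∉A))

-- Critical graphs with a separation

module Sides {n : ℕ} (G : Graph n) (crit : Domination.PairCritical G) {S : Subset n} where

  open Domination G
  open PairCritical crit

  swap : Separation S → Separation S
  swap sep = record
    { A = B ; B = A ; locate = Sum.map₂ Sum.swap ∘ locate ; A∩S = B∩S ; B∩S = A∩S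
    ; A∩B = λ x∈B x∈A → A∩B x∈A x∈B ; A≁B = λ x∈ y∈ e → A≁B y∈ x∈ (~-sym e)
    ; nbrA = nbrB ; nbrB = nbrA ; S~A = S~B ; S~B = S~A ; someA = someB ; someB = someA }
    where open Separation sep

  Free : Fin n → Set
  Free x = ∀ {s} → s ∈ S → ¬ x ~ s

  module OneSide (sep : Separation S) where

    open Separation sep

    ∈A⇒≢∈B : ∀ {x y} → x ∈ A → y ∈ B → x ≢ y
    ∈A⇒≢∈B x∈ y∈ refl = A∩B x∈ y∈

    A⋫B : ∀ {x y} → x ∈ A → y ∈ B → ¬ x ▷ y
    A⋫B x∈ y∈ (inj₁ refl) = A∩B x∈ y∈
    A⋫B x∈ y∈ (inj₂ e) = A≁B x∈ y∈ e

    B⋫A : ∀ {x y} → x ∈ B → y ∈ A → ¬ x ▷ y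
    B⋫A x∈ y∈ (inj₁ refl) = A∩B y∈ x∈
    B⋫A x∈ y∈ (inj₂ e) = A≁B y∈ x∈ (~-sym e)

    -- Two vertices of A dominate nothing of B, which has at least two vertices.
    A-pair-misses-B : ∀ {x y b} → x ∈ A → y ∈ A → b ∈ B → ¬ (∀ z → z ≢ b → x ▷ z ⊎ y ▷ z)
    A-pair-misses-B x∈ y∈ b∈ dom with nbrB b∈
    ... | b′ , b′∈ , e = [ A⋫B x∈ b′∈ , A⋫B y∈ b′∈ ]′ (dom b′ (≢-sym (~-irrefl e)))

    free-nbr∈A : ∀ {p y} → p ∈ A → Free p → p ~ y → y ∈ A
    free-nbr∈A {y = y} p∈ free e with locate y
    ... | inj₁ y∈S = contradiction e (free y∈S)
    ... | inj₂ (inj₁ y∈A) = y∈A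
    ... | inj₂ (inj₂ y∈B) = contradiction e (A≁B p∈ y∈B)

    free▷⇒∈A : ∀ {p y} → p ∈ A → Free p → y ▷ p → y ∈ A
    free▷⇒∈A p∈ free (inj₁ refl) = p∈
    free▷⇒∈A p∈ free (inj₂ e) = free-nbr∈A p∈ free (~-sym e)

    -- If `p` misses `m`, criticality is applied to `m` and some `b` in `B`. Neither of them
    -- dominates `p`, so a witness must, and it lies in `A` because `p` is free. It is then not
    -- adjacent to `b`, and together with `m` it misses a second vertex of `B`.
    free-dominates-A : ∀ {p} → p ∈ A → Free p → ∀ m → m ∈ A → p ▷ m
    free-dominates-A {p} p∈ free m m∈ with m ≟ p | p ~? m
    ... | yes m≡p | _ = inj₁ m≡p
    ... | no _ | yes e = inj₂ e
    ... | no m≢p | no p≁m = ⊥-elim (cases (critical-pair b m (≢-sym (∈A⇒≢∈B m∈ b∈)) b≁m))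
      where
      b = proj₁ someB
      b∈ = proj₂ someB
      b≁m : ¬ b ~ m
      b≁m e = A≁B m∈ b∈ (~-sym e)
      m⋫p : ¬ m ▷ p
      m⋫p (inj₁ p≡m) = m≢p (sym p≡m)
      m⋫p (inj₂ e) = p≁m (~-sym e)
      cases : ¬ (Dom b m ⊎ b ⇒ m ⊎ m ⇒ b)
      cases (inj₁ dom) = [ B⋫A b∈ p∈ , m⋫p ]′ (dom p)
      cases (inj₂ (inj₁ (y , b~y , _ , dom))) =
        [ B⋫A b∈ p∈
        , (λ y▷p → A≁B (free▷⇒∈A p∈ free y▷p) b∈ (~-sym b~y))
        ]′ (dom p (≢-sym m≢p))
      cases (inj₂ (inj₂ (y , _ , _ , dom))) =
        [ m⋫p
        , (λ y▷p → A-pair-misses-B m∈ (free▷⇒∈A p∈ free y▷p) b∈ dom)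
        ]′ (dom p (∈A⇒≢∈B p∈ b∈))

    free⇏B : ∀ {p q} → p ∈ A → Free p → q ∈ B → ¬ p ⇒ q
    free⇏B p∈ free q∈ (y , p~y , _ , dom) =
      A-pair-misses-B p∈ (free-nbr∈A p∈ free p~y) q∈ dom

  module TwoSides (sep : Separation S) where

    open Separation sep
    open OneSide sep public
    module Swapped = OneSide (swap sep)

    -- Neither vertex dominates `s`, and the witness of an arrow would lie on the side of its
    -- source, leaving part of the other side undominated.
    not-both-free : ∀ {p q s} → s ∈ S → p ∈ A → Free p → q ∈ B → Free q → ⊥
    not-both-free {p} {q} {s} s∈ p∈ p-free q∈ q-free
      with critical-pair p q (∈A⇒≢∈B p∈ q∈) (A≁B p∈ q∈)
    ... | inj₁ dom =
      [ (λ { (inj₁ refl) → A∩S p∈ s∈ ; (inj₂ e) → p-free s∈ e })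
      , (λ { (inj₁ refl) → B∩S q∈ s∈ ; (inj₂ e) → q-free s∈ e })
      ]′ (dom s)
    ... | inj₂ (inj₁ p⇒q) = free⇏B p∈ p-free q∈ p⇒q
    ... | inj₂ (inj₂ q⇒p) = Swapped.free⇏B q∈ q-free p∈ q⇒p

    -- Otherwise `s` and a neighbour `a` in `A` form a dominating edge: a vertex of `A` not adjacent
    -- to `s` is free, hence dominates `a`.
    S-singleton-misses-B : ∀ {s} → s ∈ S → (∀ t → t ∈ S → t ≡ s) → ∃[ q ] (q ∈ B × ¬ s ~ q)
    S-singleton-misses-B {s} s∈ only with any? (λ q → (q ∈? B) ×-dec ¬? (s ~? q))
    ... | yes found = found
    ... | no none = ⊥-elim (no-dominating-edge s~a dom)
      where
      a = proj₁ (S~A s∈)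
      a∈ = proj₁ (proj₂ (S~A s∈))
      s~a = proj₂ (proj₂ (S~A s∈))
      dom : Dom s a
      dom x with locate x
      ... | inj₁ x∈S = inj₁ (inj₁ (only x x∈S))
      ... | inj₂ (inj₂ x∈B) =
        inj₁ (inj₂ (decidable-stable (s ~? x) λ s≁x → none (x , x∈B , s≁x)))
      ... | inj₂ (inj₁ x∈A) with s ~? x
      ... | yes s~x = inj₁ (inj₂ s~x)
      ... | no s≁x with free-dominates-A x∈A
              (λ t∈ x~t → s≁x (~-sym (subst (x ~_) (only _ t∈) x~t))) a a∈
      ... | inj₁ a≡x = inj₂ (inj₁ (sym a≡x))
      ... | inj₂ x~a = inj₂ (inj₂ (~-sym x~a))

  -- A single cut vertex would leave a free vertex on each side.
  S-not-singleton : Separation S → ∀ {s} → s ∈ S → ¬ (∀ t → t ∈ S → t ≡ s)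
  S-not-singleton sep {s} s∈ only
    with TwoSides.S-singleton-misses-B sep s∈ only
       | TwoSides.S-singleton-misses-B (swap sep) s∈ only
  ... | q , q∈ , s≁q | p , p∈ , s≁p =
    TwoSides.not-both-free sep s∈ p∈ (free s≁p) q∈ (free s≁q)
    where
    free : ∀ {x} → ¬ s ~ x → Free x
    free s≁x t∈ e = s≁x (~-sym (subst (_ ~_) (only _ t∈) e))

-- Independent sets and the cut

module IndependentSet {n : ℕ} (G : Graph n) (crit : Domination.PairCritical G) {S I : Subset n}
  (indep : ∀ {x y} → x ∈ I → y ∈ I → ¬ Domination._~_ G x y) where

  open Domination G
  open PairCritical crit
  open Sides G crit {S}

  I⋫I : ∀ {x y} → x ∈ I → y ∈ I → y ≢ x → ¬ x ▷ y
  I⋫I x∈ y∈ y≢x (inj₁ y≡x) = y≢x y≡x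
  I⋫I x∈ y∈ y≢x (inj₂ e) = indep x∈ y∈ e

  -- The third vertex `w` of the independent set is dominated by neither `u` nor `v`.
  orient : ∀ {u v w} → u ∈ I → v ∈ I → w ∈ I → u ≢ v → w ≢ u → w ≢ v → u ⇒ v ⊎ v ⇒ u
  orient {u} {v} {w} u∈ v∈ w∈ u≢v w≢u w≢v with critical-pair u v u≢v (indep u∈ v∈)
  ... | inj₁ dom = ⊥-elim ([ I⋫I u∈ w∈ w≢u , I⋫I v∈ w∈ w≢v ]′ (dom w))
  ... | inj₂ arrow = arrow

  -- Inside `I` the vertex `u` dominates only itself, so the remaining vertices fall to the witness,
  -- which is itself outside `I` because it is adjacent to `u`.
  witness~I : ∀ {u v w} → u ∈ I → (arrow : u ⇒ v) → w ∈ I → w ≢ v → proj₁ arrow ~ w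
  witness~I {u} {w = w} u∈ (y , u~y , _ , dom) w∈ w≢v with w ≟ u
  ... | yes refl = ~-sym u~y
  ... | no w≢u with dom w w≢v
  ... | inj₁ u▷w = contradiction u▷w (I⋫I u∈ w∈ w≢u)
  ... | inj₂ (inj₁ refl) = contradiction u~y (indep u∈ w∈)
  ... | inj₂ (inj₂ e) = e

  -- If `S ⊆ I`, then `p` is free and each vertex of `S` is adjacent to all of `A - p`. The witness
  -- of an arrow between two vertices of `S` is a neighbour of `p`, so it lies in `A - p` and is
  -- adjacent to the target after all.
  S⊈I : (sep : Separation S) → let open Separation sep in
    ∀ {p s s′} → p ∈ A → p ∈ I → s ∈ S → s′ ∈ S → s ≢ s′ → ¬ S ⊆ I
  S⊈I sep {p} {s} {s′} p∈A p∈I s∈ s′∈ s≢s′ S⊆I =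
    [ no-arrow s∈ s′∈ (S~A-p s′∈ s∈ (≢-sym s≢s′)) 
    , no-arrow s′∈ s∈ (S~A-p s∈ s′∈ s≢s′)
    ]′
      (orient (S⊆I s∈) (S⊆I s′∈) p∈I s≢s′ (A≢S s∈) (A≢S s′∈))
    where
    open Separation sep
    open TwoSides sep
    p-free : Free p
    p-free t∈ = indep p∈I (S⊆I t∈)
    A≢S : ∀ {t} → t ∈ S → p ≢ t
    A≢S t∈ refl = A∩S p∈A t∈
    -- A witness of `p ⇒ t` lies in `A`, so `B` stays undominated. A witness of `t ⇒ p` can only lie
    -- in `B`, so `t` alone has to cover `A - p`.
    S~A-p : ∀ {t u} → t ∈ S → u ∈ S → t ≢ u → ∀ {a} → a ∈ A → a ≢ p → t ~ a
    S~A-p {t} {u} t∈ u∈ t≢u {a} a∈ a≢p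
      with orient (S⊆I t∈) p∈I (S⊆I u∈) (≢-sym (A≢S t∈)) (≢-sym t≢u) (≢-sym (A≢S u∈))
    ... | inj₂ (y , p~y , _ , dom) = let b , b∈ = someB in
      ⊥-elim ([ A⋫B p∈A b∈ , A⋫B (free-nbr∈A p∈A p-free p~y) b∈ ]′
        (dom b λ { refl → B∩S b∈ t∈ }))
    ... | inj₁ (z , t~z , z≁p , dom) with locate z
    ... | inj₁ z∈S = contradiction t~z (indep (S⊆I t∈) (S⊆I z∈S))
    ... | inj₂ (inj₁ z∈A) with free-dominates-A p∈A p-free z z∈A
    ... | inj₁ refl = contradiction t~z (indep (S⊆I t∈) p∈I)
    ... | inj₂ p~z = contradiction (~-sym p~z) z≁p
    S~A-p {t} t∈ u∈ t≢u {a} a∈ a≢p | inj₁ (z , t~z , z≁p , dom) | inj₂ (inj₂ z∈B) with dom a a≢p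
    ... | inj₁ (inj₁ refl) = contradiction t∈ (A∩S a∈)
    ... | inj₁ (inj₂ t~a) = t~a
    ... | inj₂ z▷a = contradiction z▷a (B⋫A z∈B a∈)
    no-arrow : ∀ {t u} → t ∈ S → u ∈ S → (∀ {a} → a ∈ A → a ≢ p → u ~ a) → ¬ t ⇒ u
    no-arrow t∈ u∈ u~ arrow@(y , t~y , y≁u , _) =
      y≁u (~-sym (u~ (free-nbr∈A p∈A p-free (~-sym (witness~I (S⊆I t∈) arrow p∈I (A≢S u∈))))
                     λ { refl → indep (S⊆I t∈) p∈I t~y }))

  -- The witness of an arrow `u ⇒ v` inside `A ∩ I` cannot lie in `A` or `B`, nor in `S ∩ I`, so it
  -- is `c`. Then `v` has no neighbour in `S` and dominates `A`, contradicting that `u` and `v` are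
  -- independent.
  same-side : (sep : Separation S) → let open Separation sep in
    ∀ {p p′ c s} → (∀ {t} → t ∈ S → t ≢ c → t ∈ I) → s ∈ S → s ∈ I →
    p ∈ A → p ∈ I → p′ ∈ A → p′ ∈ I → p ≡ p′
  same-side sep {p} {p′} {c} {s} S-c⊆I s∈S s∈I p∈A p∈I p′∈A p′∈I =
    decidable-stable (p ≟ p′) λ p≢p′ →
      [ no-arrow p∈A p∈I p′∈A p′∈I (≢-sym p≢p′) , no-arrow p′∈A p′∈I p∈A p∈I p≢p′ ]′
        (orient p∈I p′∈I s∈I p≢p′ (s≢ p∈A) (s≢ p′∈A))
    where
    open Separation sep
    open TwoSides sep
    s≢ : ∀ {a} → a ∈ A → s ≢ a
    s≢ a∈ refl = A∩S a∈ s∈S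
    no-arrow : ∀ {u v} → u ∈ A → u ∈ I → v ∈ A → v ∈ I → v ≢ u → ¬ u ⇒ v
    no-arrow {u} {v} u∈A u∈I v∈A v∈I v≢u (y , u~y , y≁v , dom) with locate y
    ... | inj₂ (inj₂ y∈B) = A≁B u∈A y∈B u~y
    ... | inj₂ (inj₁ y∈A) = let b , b∈ = someB in
      [ A⋫B u∈A b∈ , A⋫B y∈A b∈ ]′ (dom b (≢-sym (∈A⇒≢∈B v∈A b∈)))
    ... | inj₁ y∈S with y ≟ c
    ... | no y≢c = indep u∈I (S-c⊆I y∈S y≢c) u~y
    ... | yes refl = I⋫I v∈I u∈I (≢-sym v≢u) (free-dominates-A v∈A v-free u u∈A)
      where
      v-free : Free v
      v-free {t} t∈ v~t with t ≟ y
      ... | yes refl = y≁v (~-sym v~t)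
      ... | no t≢y = indep v∈I (S-c⊆I t∈ t≢y) v~t

  -- The adjacencies forced by an arrow `p ⇒ q` across the cut

  module Structure (sep : Separation S) {p q c s : Fin n}
    (p∈A : p ∈ Separation.A sep) (p∈I : p ∈ I) (q∈B : q ∈ Separation.B sep) (q∈I : q ∈ I)
    (c∈S : c ∈ S) (S-c⊆I : ∀ {t} → t ∈ S → t ≢ c → t ∈ I)
    (s∈S : s ∈ S) (s≢c : s ≢ c) (p⇒q : p ⇒ q) (degree≥3 : ∀ x → 3 ≤ degree G x) where

    open Separation sep
    open TwoSides sep

    s∈I : s ∈ I
    s∈I = S-c⊆I s∈S s≢c

    A≢S : ∀ {a t} → a ∈ A → t ∈ S → a ≢ t
    A≢S a∈ t∈ refl = A∩S a∈ t∈

    B≢S : ∀ {b t} → b ∈ B → t ∈ S → b ≢ t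
    B≢S b∈ t∈ refl = B∩S b∈ t∈

    -- A witness in `A` would leave a vertex of `B` undominated, and `c` is the only vertex of `S`
    -- that can be adjacent to `p`.
    witness≡c : (arrow : p ⇒ q) → proj₁ arrow ≡ c
    witness≡c (y , p~y , _ , dom) with locate y
    ... | inj₂ (inj₁ y∈A) = ⊥-elim (A-pair-misses-B p∈A y∈A q∈B dom)
    ... | inj₂ (inj₂ y∈B) = contradiction p~y (A≁B p∈A y∈B)
    ... | inj₁ y∈S = decidable-stable (y ≟ c) λ y≢c → indep p∈I (S-c⊆I y∈S y≢c) p~y

    c≁q : ¬ c ~ q
    c≁q = subst (λ y → ¬ y ~ q) (witness≡c p⇒q) (proj₁ (proj₂ (proj₂ p⇒q)))

    c~I : ∀ {w} → w ∈ I → w ≢ q → c ~ w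
    c~I {w} w∈ w≢q = subst (_~ w) (witness≡c p⇒q) (witness~I p∈I p⇒q w∈ w≢q)

    c~p : c ~ p
    c~p = c~I p∈I (∈A⇒≢∈B p∈A q∈B)

    c~s : c ~ s
    c~s = c~I s∈I (≢-sym (B≢S q∈B s∈S))

    c~B : ∀ {b} → b ∈ B → b ≢ q → c ~ b
    c~B {b} b∈ b≢q with proj₂ (proj₂ (proj₂ p⇒q)) b b≢q
    ... | inj₁ p▷b = contradiction p▷b (A⋫B p∈A b∈)
    ... | inj₂ (inj₁ b≡y) = contradiction (trans b≡y (witness≡c p⇒q)) (B≢S b∈ c∈S)
    ... | inj₂ (inj₂ y~b) = subst (_~ b) (witness≡c p⇒q) y~b

    q-free : Free q
    q-free {t} t∈ q~t with t ≟ c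
    ... | yes refl = c≁q (~-sym q~t)
    ... | no t≢c = indep q∈I (S-c⊆I t∈ t≢c) q~t

    q~B : ∀ {b} → b ∈ B → b ≢ q → q ~ b
    q~B {b} b∈ b≢q with Swapped.free-dominates-A q∈B q-free b b∈
    ... | inj₁ b≡q = contradiction b≡q b≢q
    ... | inj₂ e = e

    ▷q⇒∈B : ∀ {y} → y ▷ q → y ∈ B
    ▷q⇒∈B = Swapped.free▷⇒∈A q∈B q-free

    -- All neighbours of `q` lie in `B`. This excludes arrows inside `I` with a target other than
    -- `p` and `q`, since their witness would be adjacent to both.
    no-common-nbr : ∀ {z} → z ~ p → ¬ z ~ q
    no-common-nbr z~p z~q = A≁B p∈A (▷q⇒∈B (inj₂ z~q)) (~-sym z~p)

    s≁p : ¬ s ~ p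
    s≁p = indep s∈I p∈I

    S⊆c,s : ∀ {t} → t ∈ S → t ≡ c ⊎ t ≡ s
    S⊆c,s {t} t∈ with t ≟ c | t ≟ s
    ... | yes t≡c | _ = inj₁ t≡c
    ... | no _ | yes t≡s = inj₂ t≡s
    ... | no t≢c | no t≢s =
      ⊥-elim ([ no-arrow t∈I s∈S , no-arrow s∈I t∈ ]′
        (orient t∈I s∈I p∈I t≢s (A≢S p∈A t∈) (A≢S p∈A s∈S)))
      where
      t∈I = S-c⊆I t∈ t≢c
      no-arrow : ∀ {u v} → u ∈ I → v ∈ S → ¬ u ⇒ v
      no-arrow u∈ v∈ arrow =
        no-common-nbr (witness~I u∈ arrow p∈I (A≢S p∈A v∈)) (witness~I u∈ arrow q∈I (B≢S q∈B v∈))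

    -- Only `s ⇒ p` is possible between `s` and `p`. Its witness is adjacent to `q`, so it lies in
    -- `B` and leaves `A - p` to `s`.
    s~A : ∀ {a} → a ∈ A → a ≢ p → s ~ a
    s~A {a} a∈ a≢p
      with orient s∈I p∈I q∈I (≢-sym (A≢S p∈A s∈S)) (B≢S q∈B s∈S) (≢-sym (∈A⇒≢∈B p∈A q∈B))
    ... | inj₂ arrow = ⊥-elim (no-common-nbr (witness~I p∈I arrow p∈I (A≢S p∈A s∈S))
                                             (witness~I p∈I arrow q∈I (B≢S q∈B s∈S)))
    ... | inj₁ arrow@(z , _ , _ , dom) with dom a a≢p
    ... | inj₁ (inj₁ a≡s) = contradiction a≡s (A≢S a∈ s∈S)
    ... | inj₁ (inj₂ e) = e
    ... | inj₂ z▷a = contradiction z▷a (B⋫A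
      (▷q⇒∈B (inj₂ (witness~I s∈I arrow q∈I (≢-sym (∈A⇒≢∈B p∈A q∈B))))) a∈)

    -- Otherwise `c` and a neighbour of `q` in `B` form a dominating edge, as `q` is the only vertex
    -- that `c` would miss.
    c-misses-A : ∃[ a ] (a ∈ A × ¬ c ~ a)
    c-misses-A with any? (λ a → (a ∈? A) ×-dec ¬? (c ~? a))
    ... | yes found = found
    ... | no none = ⊥-elim (no-dominating-edge (c~B b∈ (≢-sym (~-irrefl q~b))) dom)
      where
      b = proj₁ (nbrB q∈B)
      b∈ = proj₁ (proj₂ (nbrB q∈B))
      q~b = proj₂ (proj₂ (nbrB q∈B))
      dom : Dom c b
      dom x with locate x
      ... | inj₁ x∈S = inj₁ (Sum.map₂ (λ { refl → c~s }) (S⊆c,s x∈S))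
      ... | inj₂ (inj₁ x∈A) =
        inj₁ (inj₂ (decidable-stable (c ~? x) λ c≁x → none (x , x∈A , c≁x)))
      ... | inj₂ (inj₂ x∈B) with x ≟ q
      ... | yes refl = inj₂ (inj₂ (~-sym q~b))
      ... | no x≢q = inj₁ (inj₂ (c~B x∈B x≢q))

    a₀ : Fin n
    a₀ = proj₁ c-misses-A

    a₀∈A : a₀ ∈ A
    a₀∈A = proj₁ (proj₂ c-misses-A)

    c≁a₀ : ¬ c ~ a₀
    c≁a₀ = proj₂ (proj₂ c-misses-A)

    a₀≢p : a₀ ≢ p
    a₀≢p a₀≡p = c≁a₀ (subst (c ~_) (sym a₀≡p) c~p)

    A⋫q : ∀ {a} → a ∈ A → ¬ a ▷ q
    A⋫q a∈ = A⋫B a∈ q∈B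

    -- The witness would have to dominate `q`, hence lie in `B`, where it is not adjacent to `a`.
    A⇏ : ∀ {a v} → a ∈ A → q ≢ v → ¬ a ⇒ v
    A⇏ a∈ q≢v (y , a~y , _ , dom) =
      [ A⋫q a∈ , (λ y▷q → A≁B a∈ (▷q⇒∈B y▷q) a~y) ]′ (dom q q≢v)

    A-clique : ∀ {a a′} → a ∈ A → a′ ∈ A → a ≢ a′ → a ~ a′
    A-clique {a} {a′} a∈ a′∈ a≢a′ = decidable-stable (a ~? a′) λ a≁a′ →
      cases (critical-pair a a′ a≢a′ a≁a′)
      where
      cases : ¬ (Dom a a′ ⊎ a ⇒ a′ ⊎ a′ ⇒ a)
      cases (inj₁ dom) = [ A⋫q a∈ , A⋫q a′∈ ]′ (dom q)
      cases (inj₂ (inj₁ arrow)) = A⇏ a∈ (≢-sym (∈A⇒≢∈B a′∈ q∈B)) arrow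
      cases (inj₂ (inj₂ arrow)) = A⇏ a′∈ (≢-sym (∈A⇒≢∈B a∈ q∈B)) arrow

    -- No vertex of S dominates A: c misses a₀ and s misses p.
    B⇏ : ∀ {b v} → b ∈ B → v ∉ A → ¬ b ⇒ v
    B⇏ {b} {v} b∈ v∉A (y , b~y , _ , dom) with locate y
    ... | inj₂ (inj₁ y∈A) = A≁B y∈A b∈ (~-sym b~y)
    ... | inj₂ (inj₂ y∈B) = [ B⋫A b∈ p∈A , B⋫A y∈B p∈A ]′ (dom p λ { refl → v∉A p∈A })
    ... | inj₁ y∈S with S⊆c,s y∈S
    ... | inj₁ refl =
      [ B⋫A b∈ a₀∈A
      , (λ { (inj₁ a₀≡c) → A≢S a₀∈A c∈S a₀≡c ; (inj₂ e) → c≁a₀ e })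
      ]′ (dom a₀ λ a₀≡v → v∉A (subst (_∈ A) a₀≡v a₀∈A))
    ... | inj₂ refl = [ B⋫A b∈ p∈A , I⋫I s∈I p∈I (A≢S p∈A s∈S) ]′ (dom p λ { refl → v∉A p∈A })

    B-clique : ∀ {b b′} → b ∈ B → b′ ∈ B → b ≢ b′ → b ~ b′
    B-clique {b} {b′} b∈ b′∈ b≢b′ = decidable-stable (b ~? b′) λ b≁b′ →
      cases (critical-pair b b′ b≢b′ b≁b′)
      where
      cases : ¬ (Dom b b′ ⊎ b ⇒ b′ ⊎ b′ ⇒ b)
      cases (inj₁ dom) = [ B⋫A b∈ p∈A , B⋫A b′∈ p∈A ]′ (dom p)
      cases (inj₂ (inj₁ arrow)) = B⇏ b∈ (λ b′∈A → A∩B b′∈A b′∈) arrow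
      cases (inj₂ (inj₂ arrow)) = B⇏ b′∈ (λ b∈A → A∩B b∈A b∈) arrow

    -- A witness of `s ⇒ b` must cover `q`, so it lies in the clique `B` and is adjacent to `b`
    -- after all. In the other cases `p` or `a₀` stays undominated.
    s~B : ∀ {b} → b ∈ B → b ≢ q → s ~ b
    s~B {b} b∈ b≢q = decidable-stable (s ~? b) λ s≁b →
      cases s≁b (critical-pair s b (≢-sym (B≢S b∈ s∈S)) s≁b)
      where
      cases : ¬ s ~ b → ¬ (Dom s b ⊎ s ⇒ b ⊎ b ⇒ s)
      cases _ (inj₁ dom) = [ I⋫I s∈I p∈I (A≢S p∈A s∈S) , B⋫A b∈ p∈A ]′ (dom p)
      cases s≁b (inj₂ (inj₁ (y , s~y , y≁b , dom))) =
        [ I⋫I s∈I q∈I (B≢S q∈B s∈S)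
        , (λ y▷q → y≁b (B-clique (▷q⇒∈B y▷q) b∈ λ { refl → s≁b s~y }))
        ]′ (dom q (≢-sym b≢q))
      cases _ (inj₂ (inj₂ arrow)) = B⇏ b∈ (λ s∈A → A∩S s∈A s∈S) arrow

    -- Uniqueness of `a₀`, from criticality of the pair `c`, `a₀`: a witness of `c ⇒ a₀` must cover
    -- `q`, so it lies in `B`, and `c` has to cover `A - a₀` alone.
    c~A : ∀ {a} → a ∈ A → a ≢ a₀ → c ~ a
    c~A {a} a∈ a≢a₀ = decidable-stable (c ~? a) λ c≁a →
      cases c≁a (critical-pair c a₀ (≢-sym (A≢S a₀∈A c∈S)) c≁a₀)
      where
      c⋫q : ¬ c ▷ q
      c⋫q (inj₁ q≡c) = B≢S q∈B c∈S q≡c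
      c⋫q (inj₂ e) = c≁q e
      cases : ¬ c ~ a → ¬ (Dom c a₀ ⊎ c ⇒ a₀ ⊎ a₀ ⇒ c)
      cases _ (inj₁ dom) = [ c⋫q , A⋫q a₀∈A ]′ (dom q)
      cases c≁a (inj₂ (inj₁ (y , _ , _ , dom))) =
        [ c⋫q
        , (λ y▷q → [ (λ { (inj₁ a≡c) → A≢S a∈ c∈S a≡c ; (inj₂ e) → c≁a e })
                   , B⋫A (▷q⇒∈B y▷q) a∈ ]′ (dom a a≢a₀))
        ]′ (dom q (≢-sym (∈A⇒≢∈B a₀∈A q∈B)))
      cases _ (inj₂ (inj₂ arrow)) = A⇏ a₀∈A (B≢S q∈B c∈S) arrow

    J₁ : Subset n
    J₁ = B - q

    J₁⊆B : ∀ {x} → x ∈ J₁ → x ∈ B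
    J₁⊆B = p─q⊆p B ⁅ q ⁆

    J₁≢q : ∀ {x} → x ∈ J₁ → x ≢ q
    J₁≢q = x∈p-y⇒x≢y B

    -- The neighbourhood of `q` is contained in `J₁`.
    |J₁|≥3 : 3 ≤ ∣ J₁ ∣
    |J₁|≥3 = ≤-trans (degree≥3 q) (p⊆q⇒∣p∣≤∣q∣ λ z∈ → let q~z = nbrs∈ z∈ in
      x∈p∧x≢y⇒x∈p-y (Swapped.free-nbr∈A q∈B q-free q~z) (≢-sym (~-irrefl q~z)))

    -- All neighbours of `p` except `c` lie in `A - p`; the loss of `c` is made up by `p` itself.
    |A|≥3 : 3 ≤ ∣ A ∣
    |A|≥3 = ≤-trans (degree≥3 p)
      (≤-trans (p-x⊆q⇒∣p∣≤1+∣q∣ {x = c} λ z z∈ → nbrs-p (nbrs∈ z∈)) (x∈p⇒∣p-x∣<∣p∣ p∈A))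
      where
      nbrs-p : ∀ {z} → p ~ z → z ≢ c → z ∈ A - p
      nbrs-p {z} p~z z≢c with locate z
      ... | inj₂ (inj₁ z∈A) = x∈p∧x≢y⇒x∈p-y z∈A (≢-sym (~-irrefl p~z))
      ... | inj₂ (inj₂ z∈B) = contradiction p~z (A≁B p∈A z∈B)
      ... | inj₁ z∈S = contradiction p~z (indep p∈I (S-c⊆I z∈S z≢c))

    cover : ∀ x → x ∈ J₁ ⊎ x ∈ A ⊎ x ≡ s ⊎ x ≡ c ⊎ x ≡ q
    cover x with locate x
    ... | inj₁ x∈S = inj₂ (inj₂ ([ inj₂ ∘ inj₁ , inj₁ ]′ (S⊆c,s x∈S)))
    ... | inj₂ (inj₁ x∈A) = inj₂ (inj₁ x∈A)
    ... | inj₂ (inj₂ x∈B) with x ≟ q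
    ... | yes x≡q = inj₂ (inj₂ (inj₂ (inj₂ x≡q)))
    ... | no x≢q = inj₁ (x∈p∧x≢y⇒x∈p-y x∈B x≢q)

    Listed : Fin n → Fin n → Set
    Listed = ListedEdge G J₁ A a₀ p s c q

    pattern J₁J₁ x∈ y∈ = inj₁ (x∈ , y∈)
    pattern J₂J₂ x∈ y∈ = inj₂ (inj₁ (x∈ , y∈))
    pattern v₁J₁ y∈ = inj₂ (inj₂ (inj₁ (refl , y∈)))
    pattern w₁- h = inj₂ (inj₂ (inj₂ (inj₁ (refl , h))))
    pattern w- h = inj₂ (inj₂ (inj₂ (inj₂ (refl , h))))

    Listed⇒~ : ∀ {x y} → x ≢ y → Listed x y → x ~ y
    Listed⇒~ x≢y (J₁J₁ x∈ y∈) = B-clique (J₁⊆B x∈) (J₁⊆B y∈) x≢y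
    Listed⇒~ x≢y (J₂J₂ x∈ y∈) = A-clique x∈ y∈ x≢y
    Listed⇒~ x≢y (v₁J₁ y∈) = q~B (J₁⊆B y∈) (J₁≢q y∈)
    Listed⇒~ x≢y (w₁- (inj₁ y∈)) = c~B (J₁⊆B y∈) (J₁≢q y∈)
    Listed⇒~ x≢y (w₁- (inj₂ (inj₁ (y∈ , y≢a₀)))) = c~A y∈ y≢a₀
    Listed⇒~ x≢y (w₁- (inj₂ (inj₂ refl))) = c~s
    Listed⇒~ x≢y (w- (inj₁ y∈)) = s~B (J₁⊆B y∈) (J₁≢q y∈)
    Listed⇒~ x≢y (w- (inj₂ (inj₁ (y∈ , y≢p)))) = s~A y∈ y≢p
    Listed⇒~ x≢y (w- (inj₂ (inj₂ refl))) = ~-sym c~s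

    pattern in-J₁ h = inj₁ h
    pattern in-A h = inj₂ (inj₁ h)
    pattern is-s = inj₂ (inj₂ (inj₁ refl))
    pattern is-c = inj₂ (inj₂ (inj₂ (inj₁ refl)))
    pattern is-q = inj₂ (inj₂ (inj₂ (inj₂ refl)))

    ~⇒Listed : ∀ {x y} → x ~ y → Listed x y ⊎ Listed y x
    ~⇒Listed {x} {y} e with cover x | cover y
    ... | in-J₁ x∈ | in-J₁ y∈ = inj₁ (J₁J₁ x∈ y∈)
    ... | in-J₁ x∈ | in-A y∈ = contradiction (~-sym e) (A≁B y∈ (J₁⊆B x∈))
    ... | in-J₁ x∈ | is-s = inj₂ (w- (inj₁ x∈))
    ... | in-J₁ x∈ | is-c = inj₂ (w₁- (inj₁ x∈))
    ... | in-J₁ x∈ | is-q = inj₂ (v₁J₁ x∈)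
    ... | in-A x∈ | in-J₁ y∈ = contradiction e (A≁B x∈ (J₁⊆B y∈))
    ... | in-A x∈ | in-A y∈ = inj₁ (J₂J₂ x∈ y∈)
    ... | in-A x∈ | is-s = inj₂ (w- (inj₂ (inj₁ (x∈ , λ { refl → s≁p (~-sym e) }))))
    ... | in-A x∈ | is-c =
      inj₂ (w₁- (inj₂ (inj₁ (x∈ , λ x≡a₀ → c≁a₀ (subst (c ~_) x≡a₀ (~-sym e))))))
    ... | in-A x∈ | is-q = contradiction e (A≁B x∈ q∈B)
    ... | is-s | in-J₁ y∈ = inj₁ (w- (inj₁ y∈))
    ... | is-s | in-A y∈ = inj₁ (w- (inj₂ (inj₁ (y∈ , λ { refl → s≁p e }))))
    ... | is-s | is-s = contradiction refl (~-irrefl e)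
    ... | is-s | is-c = inj₁ (w- (inj₂ (inj₂ refl)))
    ... | is-s | is-q = contradiction e (indep s∈I q∈I)
    ... | is-c | in-J₁ y∈ = inj₁ (w₁- (inj₁ y∈))
    ... | is-c | in-A y∈ = inj₁ (w₁- (inj₂ (inj₁ (y∈ , λ y≡a₀ → c≁a₀ (subst (c ~_) y≡a₀ e)))))
    ... | is-c | is-s = inj₁ (w₁- (inj₂ (inj₂ refl)))
    ... | is-c | is-c = contradiction refl (~-irrefl e)
    ... | is-c | is-q = contradiction e c≁q
    ... | is-q | in-J₁ y∈ = inj₁ (v₁J₁ y∈)
    ... | is-q | in-A y∈ = contradiction (~-sym e) (A≁B y∈ q∈B)
    ... | is-q | is-s = contradiction e (q-free s∈S)
    ... | is-q | is-c = contradiction e (q-free c∈S)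
    ... | is-q | is-q = contradiction refl (~-irrefl e)

    inG233 : InG233 G
    inG233 = record
      { J₁ = J₁ ; J₂ = A ; u₁ = a₀ ; u₂ = p ; w = s ; w₁ = c ; v₁ = q
      ; |J₁|≥3 = |J₁|≥3 ; |J₂|≥3 = |A|≥3
      ; u₁∈J₂ = a₀∈A ; u₂∈J₂ = p∈A ; u₁≢u₂ = a₀≢p
      ; J₁∩J₂ = λ x x∈J₁ x∈A → A∩B x∈A (J₁⊆B x∈J₁)
      ; w∉J₁ = λ s∈ → B∩S (J₁⊆B s∈) s∈S
      ; w∉J₂ = λ s∈ → A∩S s∈ s∈S
      ; w₁∉J₁ = λ c∈ → B∩S (J₁⊆B c∈) c∈S
      ; w₁∉J₂ = λ c∈ → A∩S c∈ c∈S
      ; v₁∉J₁ = λ q∈ → J₁≢q q∈ refl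
      ; v₁∉J₂ = λ q∈ → A∩B q∈ q∈B
      ; w≢w₁ = s≢c
      ; w≢v₁ = ≢-sym (B≢S q∈B s∈S)
      ; w₁≢v₁ = ≢-sym (B≢S q∈B c∈S)
      ; cover = cover
      ; edges = λ x y x≢y →
          ~⇒Listed , [ Listed⇒~ x≢y , (λ l → ~-sym (Listed⇒~ (≢-sym x≢y) l)) ]′ }

  -- The vertex `s` serves as the third member of `I` that orients the pair; if the arrow starts at
  -- `q`, the sides are exchanged.
  different-sides : (sep : Separation S) → let open Separation sep in
    ∀ {p q c s} → p ∈ A → p ∈ I → q ∈ B → q ∈ I →
    c ∈ S → (∀ {t} → t ∈ S → t ≢ c → t ∈ I) → s ∈ S → s ≢ c →
    (∀ x → 3 ≤ degree G x) → InG233 G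
  different-sides sep {p} {q} {c} {s} p∈A p∈I q∈B q∈I c∈ S-c⊆I s∈ s≢c degree≥3
    with orient p∈I q∈I (S-c⊆I s∈ s≢c) (λ { refl → A∩B p∈A q∈B })
           (λ { refl → A∩S p∈A s∈ }) (λ { refl → B∩S q∈B s∈ })
    where open Separation sep
  ... | inj₁ p⇒q = Structure.inG233 sep p∈A p∈I q∈B q∈I c∈ S-c⊆I s∈ s≢c p⇒q degree≥3
  ... | inj₂ q⇒p = Structure.inG233 (swap sep) q∈B q∈I p∈A p∈I c∈ S-c⊆I s∈ s≢c q⇒p degree≥3

-- Case distinction on `S ⊆ I`

module _ {n : ℕ} (G : Graph n) (S I : Subset n)
  (simple : IsSimple G) (connected : IsConnected G) (critical : Is3Critical G)
  (minCut : IsMinVertexCut G S) (maxIndep : IsMaxIndependent G I)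
  (∣S∣<∣I∣ : ∣ S ∣ < ∣ I ∣) (∣S∣<δ : ∣ S ∣ < minDegree G) (∣S─I∣≤1 : ∣ S ─ I ∣ ≤ 1) where

  open Domination G

  private
    ∣S∣<degree : ∀ x → ∣ S ∣ < degree G x
    ∣S∣<degree x = ≤-trans ∣S∣<δ (minDegree≤ x)

    open MinCut G S simple minCut ∣S∣<degree

    crit : PairCritical
    crit = Criticality.pairCritical G simple
      (λ x → let y , e , _ = nbr-outside-S x in y , e) critical

    indep : ∀ {x y} → x ∈ I → y ∈ I → ¬ x ~ y
    indep {x} {y} x∈ y∈ e with trans (sym e) (proj₁ maxIndep x y x∈ y∈)
    ... | ()

    open Separation separation
    open Sides G crit {S}
    open IndependentSet G crit {S} {I} indep

    -- With `S` empty, a walk starting in `A` could never reach `B`.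
    S-nonempty : ∃[ s ] s ∈ S
    S-nonempty with any? (_∈? S)
    ... | yes found = found
    ... | no none = let a , a∈ = someA; b , b∈ = someB in
      contradiction b∈ (A∩B (Reach-A (connected a b) a∈))
      where
      Reach-A : ∀ {x y} → Reach G ⊤ x y → x ∈ A → y ∈ A
      Reach-A (here _) x∈ = x∈
      Reach-A (step {z = z} _ e r) x∈ with locate z
      ... | inj₁ z∈S = contradiction (z , z∈S) none
      ... | inj₂ (inj₁ z∈A) = Reach-A r z∈A
      ... | inj₂ (inj₂ z∈B) = contradiction e (A≁B x∈ z∈B)

    another-in-S : ∀ {s} → s ∈ S → ∃[ t ] (t ∈ S × t ≢ s)
    another-in-S {s} s∈ with any? (λ t → (t ∈? S) ×-dec ¬? (t ≟ s))
    ... | yes found = found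
    ... | no none = contradiction
      (λ t t∈ → decidable-stable (t ≟ s) λ t≢s → none (t , t∈ , t≢s))
      (S-not-singleton separation s∈)

    2≤∣S∣ : 2 ≤ ∣ S ∣
    2≤∣S∣ = let s , s∈ = S-nonempty; t , t∈ , t≢s = another-in-S s∈ in
      ≤-trans (s≤s (≤-trans (s≤s z≤n) (x∈p⇒∣p-x∣<∣p∣ (x∈p∧x≢y⇒x∈p-y t∈ t≢s))))
              (x∈p⇒∣p-x∣<∣p∣ s∈)

    degree≥3 : ∀ x → 3 ≤ degree G x
    degree≥3 x = ≤-trans (s≤s 2≤∣S∣) (∣S∣<degree x)

    I∖S : ∃[ p ] (p ∈ I × p ∉ S)
    I∖S = ∣p∣<∣q∣⇒∃∈∉ ∣S∣<∣I∣

    case-S⊆I : ¬ S ⊆ I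
    case-S⊆I S⊆I with I∖S | S-nonempty
    ... | p , p∈I , p∉S | s , s∈ with another-in-S s∈ | locate p
    ... | _ | inj₁ p∈S = p∉S p∈S
    ... | t , t∈ , t≢s | inj₂ (inj₁ p∈A) = S⊈I separation p∈A p∈I t∈ s∈ t≢s S⊆I
    ... | t , t∈ , t≢s | inj₂ (inj₂ p∈B) = S⊈I (swap separation) p∈B p∈I t∈ s∈ t≢s S⊆I

    -- If `p` were the only possible vertex of `I` outside `S`, then `I - p` would lie in `S - c`,
    -- and `I` would have at most as many elements as `S`.
    another-in-I∖S : ∀ {c p} → c ∈ S → c ∉ I → ∃[ p′ ] (p′ ∈ I × p′ ∉ S × p′ ≢ p)
    another-in-I∖S {c} {p} c∈ c∉I
      with any? (λ x → (x ∈? I) ×-dec ¬? (x ∈? S) ×-dec ¬? (x ≟ p))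
    ... | yes found = found
    ... | no none = contradiction
      (≤-trans (p-x⊆q⇒∣p∣≤1+∣q∣ {q = S - c} {x = p} λ z z∈ z≢p →
          x∈p∧x≢y⇒x∈p-y (decidable-stable (z ∈? S) λ z∉S → none (z , z∈ , z∉S , z≢p))
                        λ { refl → c∉I z∈ })
        (x∈p⇒∣p-x∣<∣p∣ c∈))
      (<⇒≱ ∣S∣<∣I∣)

    case-c∉I : ∀ {c} → c ∈ S → c ∉ I → InG233 G
    case-c∉I {c} c∈ c∉I
      with I∖S | another-in-S c∈
    ... | p , p∈I , p∉S | s , s∈ , s≢c
      with another-in-I∖S {p = p} c∈ c∉I
    ... | p′ , p′∈I , p′∉S , p′≢p = cases (locate p) (locate p′)
      where
      -- `c` already accounts for the one vertex that `S` may have outside `I`.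
      S-c⊆I : ∀ {t} → t ∈ S → t ≢ c → t ∈ I
      S-c⊆I {t} t∈ t≢c = decidable-stable (t ∈? I) λ t∉I →
        t≢c (∣p∣≤1⇒x≡y ∣S─I∣≤1 (x∈p∧x∉q⇒x∈p─q c∈ c∉I) (x∈p∧x∉q⇒x∈p─q t∈ t∉I))
      s∈I = S-c⊆I s∈ s≢c
      cases : p ∈ S ⊎ p ∈ A ⊎ p ∈ B → p′ ∈ S ⊎ p′ ∈ A ⊎ p′ ∈ B → InG233 G
      cases (inj₁ p∈S) _ = contradiction p∈S p∉S
      cases _ (inj₁ p′∈S) = contradiction p′∈S p′∉S
      cases (inj₂ (inj₁ p∈A)) (inj₂ (inj₁ p′∈A)) =
        contradiction (same-side separation S-c⊆I s∈ s∈I p′∈A p′∈I p∈A p∈I) p′≢p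
      cases (inj₂ (inj₂ p∈B)) (inj₂ (inj₂ p′∈B)) =
        contradiction (same-side (swap separation) S-c⊆I s∈ s∈I p′∈B p′∈I p∈B p∈I) p′≢p
      cases (inj₂ (inj₁ p∈A)) (inj₂ (inj₂ p′∈B)) =
        different-sides separation p∈A p∈I p′∈B p′∈I c∈ S-c⊆I s∈ s≢c degree≥3
      cases (inj₂ (inj₂ p∈B)) (inj₂ (inj₁ p′∈A)) =
        different-sides separation p′∈A p′∈I p∈B p∈I c∈ S-c⊆I s∈ s≢c degree≥3

  in-G₂33 : InG233 G
  in-G₂33 with any? (λ c → (c ∈? S) ×-dec ¬? (c ∈? I))
  ... | yes (c , c∈ , c∉I) = case-c∉I c∈ c∉I
  ... | no none = ⊥-elim (case-S⊆I λ {t} t∈ →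
    decidable-stable (t ∈? I) λ t∉I → none (t , t∈ , t∉I))

theorem3p5 : ∀ {n : ℕ} (G : Graph n) (S I : Subset n) →
    IsSimple G → IsConnected G → Is3Critical G →
    IsMinVertexCut G S → IsMaxIndependent G I →
    ∣ S ∣ + 1 ≤ ∣ I ∣ → ∣ S ∣ < minDegree G → ∣ S ─ I ∣ ≤ 1 →
    InG233 G
theorem3p5 G S I simple connected critical minCut maxIndep ∣S∣+1≤∣I∣ =
  in-G₂33 G S I simple connected critical minCut maxIndep
    (subst (_≤ ∣ I ∣) (+-comm ∣ S ∣ 1) ∣S∣+1≤∣I∣)
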